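{- There are absolute constants $c>0$ and $H_0$ such that, for every integer $H\ge H_0$, every $\epsilon\in\{1,2\}$, every $r\in\{1,\dots,H\}$, and every partition $L\sqcup U=\{1,\dots,H\}\setminus\{r\}$ (the parts $L,U$ are disjoint and may be arbitrary), with $N=2H+\epsilon$ and $$J=\{0\}\cup L\cup\{N-u:u\in U\}\subseteq\mathbb Z,$$ one has $$P_N(J)\ge cH^2 .$$
   Context: Let $T=N+2$. For a finite set $J\subseteq\mathbb Z$ and an integer $d\ge 1$, put $$A_d(J)=\#\{(x,y)\in J^2: x-y=d\},\qquad B_d(J)=\#\{(x,y)\in J^2: x+y=d-1\},$$ where the equations are in ordinary integers and pairs are ordered, and $$P_N(J)=\sum_{d=1}^{N+1}\bigl(A_d(J)+B_d(J)\bigr)\bigl(A_{T-d}(J)+B_{T-d}(J)\bigr).$$ -}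

module Defs where

open import Data.Integer as ℤ using (ℤ; +_; 0ℤ; 1ℤ)
open import Data.List using (List; _∷_; _++_; map; filter; length; applyUpTo; cartesianProduct; deduplicate)
open import Data.List.Membership.Propositional using () renaming (_∈_ to _∈ᴸ_)
open import Data.List.Relation.Unary.Unique.Propositional using (Unique)
open import Data.List.Relation.Unary.Unique.DecPropositional.Properties ℤ._≟_ using (deduplicate-!)
open import Data.Nat using (ℕ; suc; _+_; _*_; _∸_; _≤_)
open import Data.Nat.ListAction using (sum)
open import Data.Product using (_×_; _,_)
open import Data.Sum using (_⊎_)
open import Function using (_⇔_)
open import Relation.Binary.PropositionalEquality using (_≢_)
open import Relation.Nullary using (¬_)

-- Finite sets are duplicate-free enumerations; nothing below depends on
-- the order of the enumeration.
record FinSet (A : Set) : Set where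
  constructor mkFinSet
  field
    elements : List A
    unique   : Unique elements

open FinSet public

infix 4 _∈_

_∈_ : {A : Set} → A → FinSet A → Set
x ∈ S = x ∈ᴸ elements S

fromList : List ℤ → FinSet ℤ
fromList xs = mkFinSet (deduplicate ℤ._≟_ xs) (deduplicate-! xs)

A[_] : ℕ → FinSet ℤ → ℕ
A[ d ] J = length (filter (λ (x , y) → (x ℤ.- y) ℤ.≟ + d)
                          (cartesianProduct (elements J) (elements J)))

B[_] : ℕ → FinSet ℤ → ℕ
B[ d ] J = length (filter (λ (x , y) → (x ℤ.+ y) ℤ.≟ (+ d ℤ.- 1ℤ))
                          (cartesianProduct (elements J) (elements J)))

-- applyUpTo suc (N + 1) is the list 1, …, N + 1, so the truncated
-- subtraction T ∸ d is always the genuine T − d ≥ 1.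
P : ℕ → FinSet ℤ → ℕ
P N J = sum (map (λ d → (A[ d ] J + B[ d ] J) * (A[ T ∸ d ] J + B[ T ∸ d ] J))
                 (applyUpTo suc (N + 1)))
  where
  T : ℕ
  T = N + 2

record IsPartition (H r : ℕ) (L U : FinSet ℕ) : Set where
  field
    covers   : ∀ x → (x ∈ L ⊎ x ∈ U) ⇔ (1 ≤ x × x ≤ H × x ≢ r)
    disjoint : ∀ x → ¬ (x ∈ L × x ∈ U)

J[_] : ℕ → FinSet ℕ → FinSet ℕ → FinSet ℤ
J[ N ] L U = fromList (0ℤ ∷ map +_ (elements L) ++ map (λ u → + N ℤ.- + u) (elements U))

{-# OPTIONS --safe #-}
module Submission where

-- Write T = N + 2, F = A + B and call k ≤ H a zero if F(T − (k + 1)) = 0.  Put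
-- In = {0} ∪ L.  Every k that is not a zero contributes at least A(k + 1) to P.
-- Of i, i + p, i + p + q (none equal to r) two lie on the same side of the
-- partition, and both sides yield pairs of J with the corresponding difference;
-- hence A(p) + A(q) + A(p + q) is at least linear in H when p + q is at most a
-- fixed fraction of H.  So it suffices to find linearly many well-spaced triples
-- k, k′, k + k′ + 1 of non-zeros.
--
-- A zero k makes In invariant, up to the missing point r, under x ↦ x + k and
-- under x ↦ k − 1 − x, and forbids x + y = N − k with x, y in In.  Three zeros
-- within distance 4, all below r or all above 2r + 4, are therefore impossible:
-- composing two reflections gives translations by the gaps between the zeros, which
-- carry In over all of [0, k) ∖ {r}, and translation by k then covers [0, H]
-- up to the points r + qk, so that some x + y = N − k does occur.  With at
-- most two zeros in each window of five, every window contains k and k′ that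
-- are non-zeros with k + k′ + 1 also a non-zero.

open import Defs
open import Data.Empty using (⊥; ⊥-elim)
open import Data.Fin using (Fin; toℕ)
open import Data.Fin.Properties using (toℕ<n; toℕ-injective; injective⇒≤)
open import Data.Integer as ℤ using (ℤ; +_; 0ℤ; 1ℤ; ∣_∣)
import Data.Integer.Properties as ℤₚ
import Data.Integer.Tactic.RingSolver as ℤSolver
open import Data.List using (List; []; _∷_; _++_; map; filter; length; lookup; applyUpTo; cartesianProduct)
open import Data.List.Membership.Propositional using () renaming (_∈_ to _∈ᴸ_)
open import Data.List.Membership.Propositional.Properties using (∈-filter⁺; ∈-cartesianProduct⁺; ∈-length; ∈-deduplicate⁺; ∈-++⁺ˡ; ∈-++⁺ʳ; ∈-map⁺)
open import Data.List.Properties using (length-++; length-map; applyUpTo-∷ʳ; map-applyUpTo)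
open import Data.List.Relation.Unary.Any using (here; there; index)
open import Data.List.Relation.Unary.Any.Properties using (lookup-index)
open import Data.Nat using (ℕ; zero; suc; _+_; _*_; _∸_; _^_; _≤_; _<_; z≤n; s≤s; _≤?_; _≟_; ≢-nonZero)
open import Data.Nat.DivMod using (_%_; m≡m%n+[m/n]*n; m%n<n; m/n*n≤m; m≥n⇒m/n>0) renaming (_/_ to _div_)
open import Data.Nat.Induction using (<-rec)
open import Data.Nat.ListAction using (sum)
open import Data.Nat.ListAction.Properties using (sum-++)
open import Data.Nat.Properties
open import Data.Nat.Tactic.RingSolver using (solve-∀)
open import Data.Product using (Σ-syntax; ∃-syntax; _×_; _,_)
open import Data.Rational as ℚ using (ℚ; 0ℚ; _/_)
import Data.Rational.Properties as ℚₚ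
import Data.Rational.Unnormalised as ℚᵘ
import Data.Rational.Unnormalised.Properties as ℚᵘₚ
open import Data.Sum using (_⊎_; inj₁; inj₂; [_,_]′; map₁) renaming (map to map-⊎)
open import Data.Unit using (⊤; tt)
open import Function.Bundles using (module Equivalence)
open import Relation.Binary.PropositionalEquality using (_≡_; _≢_; refl; sym; trans; cong; cong₂; subst; subst₂; module ≡-Reasoning)
open import Relation.Nullary using (¬_; yes; no; ¬?)
open import Relation.Nullary.Decidable using (_×-dec_; decidable-stable)
open import Relation.Unary using (Decidable)

-- Pigeonhole and windows of five indices.

-- Many X a n: at least a indices below n satisfy X, listed in decreasing order.
Many : (ℕ → Set) → ℕ → ℕ → Set
Many X zero    n = ⊤
Many X (suc a) n = ∃[ k ] k < n × X k × Many X a k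

Many-mono : ∀ {X m n} a → m ≤ n → Many X a m → Many X a n
Many-mono zero    m≤n _               = tt
Many-mono (suc a) m≤n (k , k<m , rest) = k , <-≤-trans k<m m≤n , rest

pigeonhole : ∀ {X Y : ℕ → Set} n a b → a + b ≤ suc n →
             (∀ j → j < n → X j ⊎ Y j) → Many X a n ⊎ Many Y b n
pigeonhole n       zero    b       _        f = inj₁ tt
pigeonhole n       (suc a) zero    _        f = inj₂ tt
pigeonhole zero    (suc a) (suc b) (s≤s le) f with () ← subst (_≤ 0) (+-suc a b) le
pigeonhole (suc n) (suc a) (suc b) (s≤s le) f
  with f n ≤-refl
... | inj₁ x with pigeonhole n a (suc b) le (λ j j<n → f j (m<n⇒m<1+n j<n))
...   | inj₁ xs = inj₁ (n , ≤-refl , x , xs)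
...   | inj₂ ys = inj₂ (Many-mono (suc b) (n≤1+n n) ys)
pigeonhole (suc n) (suc a) (suc b) (s≤s le) f | inj₂ y
  with pigeonhole n (suc a) b (subst (_≤ suc n) (+-suc a b) le) (λ j j<n → f j (m<n⇒m<1+n j<n))
...   | inj₁ xs = inj₁ (Many-mono (suc a) (n≤1+n n) xs)
...   | inj₂ ys = inj₂ (n , ≤-refl , y , ys)

Sparse : (ℕ → Set) → ℕ → ℕ → Set
Sparse Z lo hi = ∀ {a b c} → lo ≤ a → a < b → b < c → c ≤ a + 4 → c < hi →
                 Z a → Z b → Z c → ⊥

module _ {Z : ℕ → Set} {lo hi : ℕ} (sparse : Sparse Z lo hi) where

  not-many : ∀ {w} → lo ≤ w → w + 5 ≤ hi → ¬ Many (λ j → Z (w + j)) 3 5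
  not-many {w} lo≤w w+5≤hi (c , c<5 , zc , b , b<c , zb , a , a<b , za , tt) =
    sparse (≤-trans lo≤w (m≤m+n w a)) (+-monoʳ-< w a<b) (+-monoʳ-< w b<c)
      (≤-trans (+-monoʳ-≤ w (≤-pred c<5)) (+-monoˡ-≤ 4 (m≤m+n w a)))
      (<-≤-trans (+-monoʳ-< w c<5) w+5≤hi)
      za zb zc

  -- Fix one `i` with `w + i` outside `Z`. If no `j` worked, each of the five `j` would put `w + j`
  -- or `w + i + 1 + w + j` into `Z`, so three would fall into one window of five. The bound
  -- `w + w + 10` is where the second window ends for `i = 4`. The `suc` appears because index `k`
  -- stands for the difference `k + 1`, and `(k + 1) + (k′ + 1) = (k + k′ + 1) + 1`.
  good-triple : Decidable Z → ∀ w → lo ≤ w → w + w + 10 ≤ hi →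
    ∃[ i ] ∃[ j ] i < 5 × j < 5 × ¬ Z (w + i) × ¬ Z (w + j) × ¬ Z (suc (w + i + (w + j)))
  good-triple Z? w lo≤w 2w+10≤hi with anyUpTo? (λ i → ¬? (Z? (w + i))) 5
  ... | no none = ⊥-elim (not-many lo≤w w+5≤hi (
          4 , ≤-refl , z 4 ≤-refl ,
          3 , ≤-refl , z 3 (s≤s (m≤m+n 3 1)) ,
          2 , ≤-refl , z 2 (s≤s (m≤m+n 2 2)) , tt))
    where
    w+5≤hi : w + 5 ≤ hi
    w+5≤hi = ≤-trans (+-mono-≤ (m≤m+n w w) (m≤m+n 5 5)) 2w+10≤hi
    z : ∀ i → i < 5 → Z (w + i)
    z i i<5 = decidable-stable (Z? (w + i)) (λ ¬z → none (i , i<5 , ¬z))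
  ... | yes (i , i<5 , ¬zi)
      with anyUpTo? (λ j → ¬? (Z? (w + j)) ×-dec ¬? (Z? (suc (w + i) + w + j))) 5
  ...   | yes (j , j<5 , ¬zj , ¬zs) =
          i , j , i<5 , j<5 , ¬zi , ¬zj , λ z → ¬zs (subst Z (sym (+-assoc (suc (w + i)) w j)) z)
  ...   | no none with pigeonhole 5 3 3 ≤-refl cases
    where
    cases : ∀ j → j < 5 → Z (w + j) ⊎ Z (suc (w + i) + w + j)
    cases j j<5 with Z? (w + j) | Z? (suc (w + i) + w + j)
    ... | yes z | _     = inj₁ z
    ... | no _  | yes z = inj₂ z
    ... | no ¬z | no ¬z′ = ⊥-elim (none (j , j<5 , ¬z , ¬z′))
  ...     | inj₁ m = ⊥-elim (not-many lo≤w (≤-trans (+-mono-≤ (m≤m+n w w) (m≤m+n 5 5)) 2w+10≤hi) m)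
  ...     | inj₂ m = ⊥-elim (not-many (≤-trans lo≤w (m≤n+m w _)) bound m)
    where
    rearrange : ∀ w → suc (w + 4) + w + 5 ≡ w + w + 10
    rearrange = solve-∀
    bound : suc (w + i) + w + 5 ≤ hi
    bound = begin
      suc (w + i) + w + 5 ≤⟨ +-monoˡ-≤ 5 (+-monoˡ-≤ w (s≤s (+-monoʳ-≤ w (≤-pred i<5)))) ⟩
      suc (w + 4) + w + 5 ≡⟨ rearrange w ⟩
      w + w + 10          ≤⟨ 2w+10≤hi ⟩
      hi                  ∎ where open ≤-Reasoning

-- Why three close zeros are impossible.

module _ (In : ℕ → Set) (r H : ℕ) where

  In∪r : ℕ → Set
  In∪r x = In x ⊎ x ≡ r

  -- The consequences of a zero for the lower half of `J` alone: `shift` and `anti` reflect that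
  -- `N - k` is not a sum, `reflect` that `N + 1 - k` is not a difference. The equation
  -- `x + suc y ≡ k` says `y = k - 1 - x` without truncated subtraction.
  record Zero (N k : ℕ) : Set where
    field
      shift   : ∀ {x} → In x → x + k ≤ H → In∪r (x + k)
      reflect : ∀ {x y} → In x → x + suc y ≡ k → In∪r y
      anti    : ∀ {x y} → In x → In y → x + y + k ≡ N → ⊥

  open Zero

  other : ∀ {x} → In∪r x → x ≢ r → In x
  other (inj₁ p) _   = p
  other (inj₂ e) x≢r = ⊥-elim (x≢r e)

  -- `y` goes to `z = k - 1 - y` and then to `k + δ - 1 - z = y + δ`. The intermediate `z` must
  -- avoid `r`, since only points of `In` can be reflected again.
  reflect-twice : ∀ {N k y z} δ → Zero N k → Zero N (k + δ) →
    z + suc y ≡ k → z ≢ r → In y → In∪r (y + δ)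
  reflect-twice {y = y} {z} δ Zk Zk+δ refl z≢r iny =
    reflect Zk+δ (other (reflect Zk iny (rearrange₁ y z)) z≢r) (rearrange₂ y z δ)
    where
    rearrange₁ : ∀ y z → y + suc z ≡ z + suc y
    rearrange₁ = solve-∀
    rearrange₂ : ∀ y z δ → z + suc (y + δ) ≡ z + suc y + δ
    rearrange₂ = solve-∀

  module _ (In0 : In 0) {N κ d′ e′ : ℕ} (d′+e′≤2 : d′ + e′ ≤ 2)
    (k₃≤H : suc κ + suc d′ + suc e′ ≤ H)
    (far : suc κ + suc d′ + suc e′ < r ⊎ r + r + 5 ≤ suc κ)
    (Z₁ : Zero N (suc κ)) (Z₂ : Zero N (suc κ + suc d′)) (Z₃ : Zero N (suc κ + suc d′ + suc e′)) where

    k₁ d e : ℕ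
    k₁ = suc κ
    d  = suc d′
    e  = suc e′

    e′≤2 : e′ ≤ 2
    e′≤2 = ≤-trans (m≤n+m e′ d′) d′+e′≤2

    k₂≤k₃ : k₁ + d ≤ k₁ + d + e
    k₂≤k₃ = m≤m+n (k₁ + d) e

    -- Ensures that the images of 0, namely `κ`, `k₁`, `κ + d` and `k₁ + d`, lie in `In` itself and
    -- can be reflected further.
    between : ∀ {x} → κ ≤ x → x ≤ k₁ + d → x ≢ r
    between {x} κ≤x x≤k₂ refl = [ before , after ]′ far
      where
      open ≤-Reasoning
      before : ¬ (k₁ + d + e < r)
      before = ≤⇒≯ (≤-trans x≤k₂ k₂≤k₃)
      after : ¬ (r + r + 5 ≤ k₁)
      after 2r+5≤k₁ = <-irrefl refl (begin-strict
        κ           ≤⟨ κ≤x ⟩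
        r           <⟨ m<m+n r (<-≤-trans (s≤s z≤n) (m≤n+m 4 r)) ⟩
        r + (r + 4) ≡⟨ +-assoc r r 4 ⟨
        r + r + 4   ≤⟨ ≤-pred (subst (_≤ k₁) (+-suc (r + r) 4) 2r+5≤k₁) ⟩
        κ           ∎)

    In-κ₁ : In κ
    In-κ₁ = other (reflect Z₁ In0 refl) (between ≤-refl (≤-trans (n≤1+n κ) (m≤m+n k₁ d)))

    In-k₁ : In k₁
    In-k₁ = other (shift Z₁ In0 (≤-trans (m≤m+n k₁ d) (≤-trans k₂≤k₃ k₃≤H)))
                  (between (n≤1+n κ) (m≤m+n k₁ d))

    In-κ₂ : In (κ + d)
    In-κ₂ = other (reflect Z₂ In0 refl) (between (m≤m+n κ d) (n≤1+n (κ + d)))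

    In-k₂ : In (k₁ + d)
    In-k₂ = other (shift Z₂ In0 (≤-trans k₂≤k₃ k₃≤H))
                  (between (≤-trans (n≤1+n κ) (m≤m+n k₁ d)) ≤-refl)

    -- Reflecting the images of 0 produces 0, `d - 1`, `d`, `e - 1`, `e` and `d + e - 1`. For
    -- `d + e ≤ 4` these exhaust the interval; `d = 1`, `e = 4` would miss 2, whence the windows of
    -- five.
    initial : ∀ x → x < d + e → In∪r x
    initial = go d′ e′ d′+e′≤2 (inj₁ In0)
      (reflect Z₂ In-k₁ refl)
      (reflect Z₂ In-κ₁ (+-suc κ d))
      (reflect Z₃ In-k₂ refl)
      (reflect Z₃ In-κ₂ (+-suc (κ + d) e))
      (reflect Z₃ In-k₁ (trans (cong (λ t → k₁ + t) (cong suc (sym (+-suc d′ e′)))) (sym (+-assoc k₁ d e))))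
      where
      go : ∀ d′ e′ → d′ + e′ ≤ 2 → In∪r 0 → In∪r d′ → In∪r (suc d′) → In∪r e′ →
           In∪r (suc e′) → In∪r (suc d′ + e′) → ∀ x → x < suc d′ + suc e′ → In∪r x
      go 0 0 _ s₀ _ s₁ _ _ _ 0 _ = s₀
      go 0 0 _ s₀ _ s₁ _ _ _ 1 _ = s₁
      go 0 1 _ s₀ _ s₁ _ s₂ _ 0 _ = s₀
      go 0 1 _ s₀ _ s₁ _ s₂ _ 1 _ = s₁
      go 0 1 _ s₀ _ s₁ _ s₂ _ 2 _ = s₂
      go 0 2 _ s₀ _ s₁ s₂ s₃ _ 0 _ = s₀
      go 0 2 _ s₀ _ s₁ s₂ s₃ _ 1 _ = s₁
      go 0 2 _ s₀ _ s₁ s₂ s₃ _ 2 _ = s₂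
      go 0 2 _ s₀ _ s₁ s₂ s₃ _ 3 _ = s₃
      go 1 0 _ s₀ s₁ s₂ _ _ _ 0 _ = s₀
      go 1 0 _ s₀ s₁ s₂ _ _ _ 1 _ = s₁
      go 1 0 _ s₀ s₁ s₂ _ _ _ 2 _ = s₂
      go 1 1 _ s₀ s₁ s₂ _ _ s₃ 0 _ = s₀
      go 1 1 _ s₀ s₁ s₂ _ _ s₃ 1 _ = s₁
      go 1 1 _ s₀ s₁ s₂ _ _ s₃ 2 _ = s₂
      go 1 1 _ s₀ s₁ s₂ _ _ s₃ 3 _ = s₃
      go 2 0 _ s₀ s₂ s₃ _ s₁ _ 0 _ = s₀
      go 2 0 _ s₀ s₂ s₃ _ s₁ _ 1 _ = s₁
      go 2 0 _ s₀ s₂ s₃ _ s₁ _ 2 _ = s₂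
      go 2 0 _ s₀ s₂ s₃ _ s₁ _ 3 _ = s₃
      go 0 0 _ _ _ _ _ _ _ (suc (suc _)) (s≤s (s≤s ()))
      go 0 1 _ _ _ _ _ _ _ (suc (suc (suc _))) (s≤s (s≤s (s≤s ())))
      go 1 0 _ _ _ _ _ _ _ (suc (suc (suc _))) (s≤s (s≤s (s≤s ())))
      go 0 2 _ _ _ _ _ _ _ (suc (suc (suc (suc _)))) (s≤s (s≤s (s≤s (s≤s ()))))
      go 1 1 _ _ _ _ _ _ _ (suc (suc (suc (suc _)))) (s≤s (s≤s (s≤s (s≤s ()))))
      go 2 0 _ _ _ _ _ _ _ (suc (suc (suc (suc _)))) (s≤s (s≤s (s≤s (s≤s ()))))
      go 0 (suc (suc (suc _))) (s≤s (s≤s ()))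
      go 1 (suc (suc _)) (s≤s (s≤s ()))
      go 2 (suc _) (s≤s (s≤s ()))
      go (suc (suc (suc _))) _ (s≤s (s≤s ()))

    -- Strong induction from the base `initial`. There are three ways to reach `x = w + (d + e)`:
    -- from `w + d` by `e`, from `w` by `d + e`, both through the mirror point `z + d + e`, and from
    -- `w + e` by `d` through `z + d`. Since `r` is a single point, it cannot block all three.
    below-k₁ : ∀ x → x < k₁ → In∪r x
    below-k₁ = <-rec _ step
      where
      step : ∀ x → (∀ {y} → y < x → y < k₁ → In∪r y) → x < k₁ → In∪r x
      step x ih x<k₁ with d + e ≤? x
      ... | no  d+e≰x = initial x (≰⇒> d+e≰x)
      ... | yes d+e≤x = subst In∪r (m∸n+n≡m d+e≤x) step′
        where
        w z : ℕ
        w = x ∸ (d + e)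
        z = k₁ ∸ suc x
        x≡ : w + (d + e) ≡ x
        x≡ = m∸n+n≡m d+e≤x
        k₁≡ : z + suc (w + (d + e)) ≡ k₁
        k₁≡ = trans (cong (λ t → z + suc t) x≡) (m∸n+n≡m x<k₁)
        ih′ : ∀ {δ} → δ < d + e → In∪r (w + δ)
        ih′ {δ} δ<d+e = ih w+δ<x (<-trans w+δ<x x<k₁)
          where w+δ<x = subst (w + δ <_) x≡ (+-monoʳ-< w δ<d+e)
        step-e : z + d + e ≢ r → In (w + d) → In∪r (w + (d + e))
        step-e z≢r p = subst In∪r (+-assoc w d e)
          (reflect-twice e Z₂ Z₃ (trans (rearrange z w d e) (cong (_+ d) k₁≡)) z≢r p)
          where
          rearrange : ∀ z w d e → z + d + e + suc (w + d) ≡ z + suc (w + (d + e)) + d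
          rearrange = solve-∀
        step-d+e : z + d + e ≢ r → In w → In∪r (w + (d + e))
        step-d+e z≢r p =
          reflect-twice (d + e) Z₁ (subst (Zero N) (+-assoc k₁ d e) Z₃)
            (trans (rearrange z w d e) k₁≡) z≢r p
          where
          rearrange : ∀ z w d e → z + d + e + suc w ≡ z + suc (w + (d + e))
          rearrange = solve-∀
        step-d : z + d ≢ r → In (w + e) → In∪r (w + (d + e))
        step-d z≢r p = subst In∪r (trans (+-assoc w e d) (cong (λ t → w + t) (+-comm e d)))
          (reflect-twice d Z₁ Z₂ (trans (rearrange z w d e) k₁≡) z≢r p)
          where
          rearrange : ∀ z w d e → z + d + suc (w + e) ≡ z + suc (w + (d + e))
          rearrange = solve-∀
        step′ : In∪r (w + (d + e))
        step′ with z + d + e ≟ r | ih′ {d} (m<m+n d (s≤s z≤n))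
        ... | no z≢r | inj₁ p = step-e z≢r p
        ... | no z≢r | inj₂ w+d≡r = step-d+e z≢r
                (other (subst In∪r (+-identityʳ w) (ih′ {0} (s≤s z≤n)))
                       (λ w≡r → m≢1+m+n w (trans (trans w≡r (sym w+d≡r)) (+-suc w d′))))
        ... | yes z≡r | _ = step-d
                (λ z+d≡r → m≢1+m+n (z + d) (trans z+d≡r (trans (sym z≡r) (+-suc (z + d) e′))))
                (other (ih′ {e} (s≤s (m≤n+m e d′))) w+e≢r)
          where
          k₃≡ : ∀ z w d e → z + suc (w + (d + e)) + d + e ≡ z + d + e + suc (w + e) + d
          k₃≡ = solve-∀
          -- If the zeros lie below `r`, already `z + d + e ≡ r` is impossible. Otherwise the two
          -- equalities would give `k₁ + e = 2r + 1`, against `2r + 5 ≤ k₁`.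
          w+e≢r : w + e ≢ r
          w+e≢r w+e≡r = [ before , after ]′ far
            where
            open ≤-Reasoning
            before : ¬ (k₁ + d + e < r)
            before = ≤⇒≯ (begin
              r          ≡⟨ z≡r ⟨
              z + d + e  ≤⟨ +-monoˡ-≤ e (+-monoˡ-≤ d (m∸n≤m k₁ (suc x))) ⟩
              k₁ + d + e ∎)
            assoc5 : ∀ r → r + r + 5 ≡ 2 + (r + r) + 3
            assoc5 = solve-∀
            after : ¬ (r + r + 5 ≤ k₁)
            after 2r+5≤k₁ = <-irrefl refl (begin-strict
              k₁ + d + e                      ≡⟨ cong (λ t → t + d + e) k₁≡ ⟨
              z + suc (w + (d + e)) + d + e   ≡⟨ k₃≡ z w d e ⟩
              z + d + e + suc (w + e) + d     ≡⟨ cong₂ (λ a b → a + suc b + d) z≡r w+e≡r ⟩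
              r + suc r + d                   ≡⟨ cong (_+ d) (+-suc r r) ⟩
              suc (r + r) + d                 <⟨ +-monoˡ-< d (m+n≤o⇒m≤o (2 + (r + r)) (subst (_≤ k₁) (assoc5 r) 2r+5≤k₁)) ⟩
              k₁ + d                          ≤⟨ k₂≤k₃ ⟩
              k₁ + d + e                      ∎)

    -- The points that repeated translation by k₁ from [0, k₁) ∖ {r} may miss.
    Bad : ℕ → Set
    Bad x = ∃[ q ] x ≡ r + q * k₁

    Bad-gap : ∀ {x y} → Bad x → Bad y → x < y → ¬ (y < x + k₁)
    Bad-gap {x} {y} (q , refl) (q′ , refl) x<y = ≤⇒≯ (begin
      r + q * k₁ + k₁ ≡⟨ rearrange r q k₁ ⟩
      r + suc q * k₁  ≤⟨ +-monoʳ-≤ r (*-monoˡ-≤ k₁ (*-cancelʳ-< k₁ q q′ (+-cancelˡ-< r _ _ x<y))) ⟩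
      r + q′ * k₁     ∎)
      where
      open ≤-Reasoning
      rearrange : ∀ r q k → r + q * k + k ≡ r + (k + q * k)
      rearrange = solve-∀

    -- Descend by `k₁` to the interval covered by `below-k₁`. An exception arises only at `r` and
    -- from then on propagates along `r + q * k₁`.
    In-or-Bad : ∀ x → x ≤ H → In x ⊎ Bad x
    In-or-Bad = <-rec _ step
      where
      widen : ∀ {x} → In∪r x → In x ⊎ Bad x
      widen (inj₁ p)   = inj₁ p
      widen (inj₂ x≡r) = inj₂ (0 , trans x≡r (sym (+-identityʳ r)))
      step : ∀ x → (∀ {y} → y < x → y ≤ H → In y ⊎ Bad y) → x ≤ H → In x ⊎ Bad x
      step x ih x≤H with k₁ ≤? x
      ... | no  k₁≰x = widen (below-k₁ x (≰⇒> k₁≰x))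
      ... | yes k₁≤x with x∸k₁+k₁≡x ← m∸n+n≡m k₁≤x
                     with ih {x ∸ k₁} (subst (x ∸ k₁ <_) x∸k₁+k₁≡x (m<m+n (x ∸ k₁) (s≤s z≤n))) (≤-trans (m∸n≤m x k₁) x≤H)
      ...   | inj₁ p = subst (λ t → In t ⊎ Bad t) x∸k₁+k₁≡x
                         (widen (shift Z₁ p (subst (_≤ H) (sym x∸k₁+k₁≡x) x≤H)))
      ...   | inj₂ (q , eq) = inj₂ (suc q , trans (sym x∸k₁+k₁≡x)
                         (trans (cong (_+ k₁) eq) (rearrange r q k₁)))
        where
        rearrange : ∀ r q k → r + q * k + k ≡ r + (k + q * k)
        rearrange = solve-∀

    -- The pairs `H - 2 + j` and `H - k₁ + ε + 2 - j`, for `j = 0, 1, 2`, all sum to `N - k₁`, so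
    -- `anti` makes one member of each bad. Two bad points then occur within distance 2 on the same
    -- side, whereas bad points are at least `k₁ ≥ 4` apart. The bound `ε + 2 ≤ 4 ≤ k₁` also keeps
    -- the second member at most `H`.
    no-three-zeros : ∀ {ε} → N ≡ 2 * H + ε → ε ≤ 2 → 4 ≤ k₁ → ⊥
    no-three-zeros {ε} N≡ ε≤2 4≤k₁ with pigeonhole 3 2 2 ≤-refl cases
      where
      h c : ℕ
      h = H ∸ k₁
      c = H ∸ 2
      h+k₁≡H : h + k₁ ≡ H
      h+k₁≡H = m∸n+n≡m (≤-trans (≤-trans (m≤m+n k₁ d) k₂≤k₃) k₃≤H)
      c+2≡H : c + 2 ≡ H
      c+2≡H = m∸n+n≡m (≤-trans (≤-trans (m≤m+n 2 2) 4≤k₁) (subst (k₁ ≤_) h+k₁≡H (m≤n+m k₁ h)))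
      total : ∀ j → j < 3 → c + j + (h + ε + (2 ∸ j)) + k₁ ≡ N
      total j (s≤s j≤2) = begin
        c + j + (h + ε + (2 ∸ j)) + k₁   ≡⟨ rearrange c j h ε (2 ∸ j) k₁ ⟩
        c + (2 ∸ j + j) + (h + k₁) + ε   ≡⟨ cong (λ t → c + t + (h + k₁) + ε) (m∸n+n≡m j≤2) ⟩
        c + 2 + (h + k₁) + ε             ≡⟨ cong₂ (λ s t → s + t + ε) c+2≡H h+k₁≡H ⟩
        H + H + ε                        ≡⟨ cong (λ t → H + t + ε) (+-identityʳ H) ⟨
        2 * H + ε                        ≡⟨ N≡ ⟨
        N                                ∎
        where
        open ≡-Reasoning
        rearrange : ∀ c j h ε i k → c + j + (h + ε + i) + k ≡ c + (i + j) + (h + k) + ε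
        rearrange = solve-∀
      cases : ∀ j → j < 3 → Bad (c + j) ⊎ Bad (h + ε + (2 ∸ j))
      cases j j<3@(s≤s j≤2)
        with In-or-Bad (c + j) (subst (c + j ≤_) c+2≡H (+-monoʳ-≤ c j≤2))
           | In-or-Bad (h + ε + (2 ∸ j)) (subst₂ _≤_ (sym (+-assoc h ε _)) h+k₁≡H
               (+-monoʳ-≤ h (≤-trans (+-mono-≤ ε≤2 (m∸n≤m 2 j)) 4≤k₁)))
      ... | inj₂ bad | _        = inj₁ bad
      ... | inj₁ _   | inj₂ bad = inj₂ bad
      ... | inj₁ p   | inj₁ q   = ⊥-elim (anti Z₁ p q (total j j<3))
    ... | inj₁ (j , s≤s j≤2 , bj , i , i<j , bi , tt) =
      Bad-gap bi bj (+-monoʳ-< (H ∸ 2) i<j) (≤-<-trans (+-monoʳ-≤ (H ∸ 2) j≤2)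
        (≤-<-trans (+-monoˡ-≤ 2 (m≤m+n (H ∸ 2) i)) (+-monoʳ-< (H ∸ 2 + i) (≤-trans (m≤m+n 3 1) 4≤k₁))))
    ... | inj₂ (j , s≤s j≤2 , bj , i , i<j , bi , tt) =
      Bad-gap bj bi (+-monoʳ-< _ (∸-monoʳ-< i<j j≤2)) (≤-<-trans (+-monoʳ-≤ (H ∸ k₁ + ε) (m∸n≤m 2 i))
        (≤-<-trans (+-monoˡ-≤ 2 (m≤m+n (H ∸ k₁ + ε) (2 ∸ j))) (+-monoʳ-< _ (≤-trans (m≤m+n 3 1) 4≤k₁))))

-- Counting by lists and prefix sums.

-- Positions of distinct numbers are distinct, so repetitions and surplus entries in `ys` are
-- harmless.
upTo⊆⇒≤-length : ∀ n (ys : List ℕ) → (∀ i → i < n → i ∈ᴸ ys) → n ≤ length ys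
upTo⊆⇒≤-length n ys mem = injective⇒≤ {f = position} position-injective
  where
  position : Fin n → Fin (length ys)
  position i = index (mem (toℕ i) (toℕ<n i))
  position-injective : ∀ {i j} → position i ≡ position j → i ≡ j
  position-injective {i} {j} eq = toℕ-injective (begin
    toℕ i                  ≡⟨ lookup-index (mem (toℕ i) (toℕ<n i)) ⟩
    lookup ys (position i) ≡⟨ cong (lookup ys) eq ⟩
    lookup ys (position j) ≡⟨ lookup-index (mem (toℕ j) (toℕ<n j)) ⟨
    toℕ j                  ∎)
    where open ≡-Reasoning

module _ (g : ℕ → ℕ) where

  prefix : ℕ → ℕ
  prefix n = sum (applyUpTo g n)

  prefix-suc : ∀ n → prefix (suc n) ≡ prefix n + g n
  prefix-suc n = begin
    sum (applyUpTo g (suc n))           ≡⟨ cong sum (applyUpTo-∷ʳ g n) ⟨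
    sum (applyUpTo g n ++ g n ∷ [])     ≡⟨ sum-++ (applyUpTo g n) (g n ∷ []) ⟩
    prefix n + (g n + 0)                ≡⟨ cong (λ t → prefix n + t) (+-identityʳ (g n)) ⟩
    prefix n + g n                      ∎
    where open ≡-Reasoning

  prefix-mono : ∀ {m n} → m ≤ n → prefix m ≤ prefix n
  prefix-mono {m} {n} m≤n = subst (λ t → prefix m ≤ prefix t) (m∸n+n≡m m≤n) (extend (n ∸ m))
    where
    extend : ∀ k → prefix m ≤ prefix (k + m)
    extend zero    = ≤-refl
    extend (suc k) = ≤-trans (extend k)
      (subst (prefix (k + m) ≤_) (sym (prefix-suc (k + m))) (m≤m+n _ _))

  prefix-gain : ∀ {m k n} → m ≤ k → k < n → prefix m + g k ≤ prefix n
  prefix-gain {m} {k} {n} m≤k k<n = begin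
    prefix m + g k ≤⟨ +-monoˡ-≤ (g k) (prefix-mono m≤k) ⟩
    prefix k + g k ≡⟨ prefix-suc k ⟨
    prefix (suc k) ≤⟨ prefix-mono k<n ⟩
    prefix n       ∎
    where open ≤-Reasoning

  -- As `w` advances by 5, the indices `w + i` and `w + j` stay in disjoint blocks, and
  -- `suc (w + i + (w + j))` stays in blocks of length 10. Hence no value of `g` is counted twice
  -- within any one of the three prefix sums.
  windows-sum : ∀ {h lo} m →
    (∀ t → t < m → let w = t * 5 + lo in
       ∃[ i ] ∃[ j ] i < 5 × j < 5 ×
         h ≤ 2 * (g (w + i) + g (w + j) + g (suc (w + i + (w + j))))) →
    let w = m * 5 + lo in
    m * h ≤ 2 * (prefix w + prefix w + prefix (suc (w + w)))
  windows-sum zero    _ = z≤n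
  windows-sum {h} {lo} (suc m) f with f m ≤-refl
  ... | i , j , i<5 , j<5 , h≤ = begin
    h + m * h
      ≤⟨ +-mono-≤ h≤ (windows-sum m (λ t t<m → f t (m<n⇒m<1+n t<m))) ⟩
    2 * (g (w + i) + g (w + j) + g s) + 2 * (prefix w + prefix w + prefix (suc (w + w)))
      ≡⟨ rearrange (g (w + i)) (g (w + j)) (g s) (prefix w) (prefix (suc (w + w))) ⟩
    2 * (prefix w + g (w + i) + (prefix w + g (w + j)) + (prefix (suc (w + w)) + g s))
      ≤⟨ *-monoʳ-≤ 2 (+-mono-≤ (+-mono-≤ (prefix-gain (m≤m+n w i) (w+<5 i<5))
                                         (prefix-gain (m≤m+n w j) (w+<5 j<5)))
           (prefix-gain (s≤s (+-mono-≤ (m≤m+n w i) (m≤m+n w j)))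
                        (s≤s (+-mono-< (w+<5 i<5) (w+<5 j<5))))) ⟩
    2 * (prefix (5 + w) + prefix (5 + w) + prefix (suc (5 + w + (5 + w))))
      ∎
    where
    open ≤-Reasoning
    w s : ℕ
    w = m * 5 + lo
    s = suc (w + i + (w + j))
    w+<5 : ∀ {i} → i < 5 → w + i < 5 + w
    w+<5 {i} i<5 = subst (w + i <_) (+-comm w 5) (+-monoʳ-< w i<5)
    rearrange : ∀ a b c x y → 2 * (a + b + c) + 2 * (x + x + y) ≡ 2 * (x + a + (x + b) + (y + c))
    rearrange = solve-∀

-- Pairs with a given difference or sum.

module _ (S : FinSet ℤ) where

  difference-pairs : ℕ → List (ℤ × ℤ)
  difference-pairs d = filter (λ (x , y) → (x ℤ.- y) ℤ.≟ + d) (cartesianProduct (elements S) (elements S))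

  ∈-difference-pairs : ∀ {x y d} → x ∈ S → y ∈ S → x ℤ.- y ≡ + d → (x , y) ∈ᴸ difference-pairs d
  ∈-difference-pairs x∈ y∈ = ∈-filter⁺ _ (∈-cartesianProduct⁺ x∈ y∈)

  A≢0 : ∀ {x y d} → x ∈ S → y ∈ S → x ℤ.- y ≡ + d → A[ d ] S ≢ 0
  A≢0 x∈ y∈ eq = m<n⇒n≢0 (∈-length (∈-difference-pairs x∈ y∈ eq))

  B≢0 : ∀ {x y d} → x ∈ S → y ∈ S → x ℤ.+ y ≡ + d ℤ.- 1ℤ → B[ d ] S ≢ 0
  B≢0 {d = d} x∈ y∈ eq = m<n⇒n≢0 (∈-length
    (∈-filter⁺ (λ (x , y) → (x ℤ.+ y) ℤ.≟ (+ d ℤ.- 1ℤ)) (∈-cartesianProduct⁺ x∈ y∈) eq))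

-- The set `J`: its zeros and its differences.

module Structure {H N r : ℕ} (L U : FinSet ℕ) (partition : IsPartition H r L U) where

  open IsPartition partition

  J : FinSet ℤ
  J = J[ N ] L U

  In : ℕ → Set
  In x = x ≡ 0 ⊎ x ∈ L

  In0 : In 0
  In0 = inj₁ refl

  listed∈J : ∀ {z} → z ∈ᴸ (0ℤ ∷ map +_ (elements L) ++ map (λ u → + N ℤ.- + u) (elements U)) → z ∈ J
  listed∈J = ∈-deduplicate⁺ ℤ._≟_

  lower∈J : ∀ {x} → In x → + x ∈ J
  lower∈J (inj₁ refl) = listed∈J (here refl)
  lower∈J (inj₂ x∈L)  = listed∈J (there (∈-++⁺ˡ (∈-map⁺ +_ x∈L)))

  upper∈J : ∀ {u} → u ∈ U → + N ℤ.- + u ∈ J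
  upper∈J u∈U = listed∈J (there (∈-++⁺ʳ (map +_ (elements L)) (∈-map⁺ (λ u → + N ℤ.- + u) u∈U)))

  side : ∀ {x} → x ≤ H → x ≢ r → In x ⊎ x ∈ U
  side {zero}  _   _   = inj₁ In0
  side {suc x} x≤H x≢r = map₁ inj₂ (Equivalence.from (covers (suc x)) (s≤s z≤n , x≤H , x≢r))

  F : ℕ → ℕ
  F d = A[ d ] J + B[ d ] J

  -- The term of `P` for `d = k + 1`; counting from 0 turns `P` into a prefix sum.
  g : ℕ → ℕ
  g k = F (suc k) * F (N + 2 ∸ suc k)

  Z : ℕ → Set
  Z k = F (N + 2 ∸ suc k) ≡ 0

  A≤g : ∀ {k} → ¬ Z k → A[ suc k ] J ≤ g k
  A≤g {k} ¬z = ≤-trans (m≤m+n _ (B[ suc k ] J)) (m≤m*n (F (suc k)) _ {{≢-nonZero ¬z}})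

  -- With `D = N + 1 - k`, a point of `U` in the wrong place would give `x + (N - (x + k)) = D - 1`,
  -- or `(N - y) - x = D` when `x + y + 1 = k`. Both are excluded by `F D ≡ 0`.
  zero-at : ∀ {k} → k ≤ H → H ≤ N → Z k → Zero In r H N k
  zero-at {k} k≤H H≤N Fz = record
    { shift   = λ {x} p x+k≤H → excluded x+k≤H λ u∈U →
        no-sum (lower∈J p) (upper∈J u∈U)
          (trans (cong (λ t → + x ℤ.+ (t ℤ.- (+ x ℤ.+ + k))) N≡) (shift-identity (+ x) (+ k) (+ D)))
    ; reflect = λ {x} {y} p x+y+1≡k →
        excluded (≤-trans (≤-trans (n≤1+n y) (m+n≤o⇒n≤o x (≤-reflexive x+y+1≡k))) k≤H) λ u∈U →
        no-diff (upper∈J u∈U) (lower∈J p)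
          (trans (cong (λ t → t ℤ.- + y ℤ.- + x)
                   (trans N≡ (cong (λ t → + D ℤ.+ + t ℤ.- 1ℤ) (sym x+y+1≡k))))
                 (reflect-identity (+ x) (+ y) (+ D)))
    ; anti    = λ {x} {y} p q x+y+k≡N →
        no-sum (lower∈J p) (lower∈J q)
          (sym (cong (λ t → + t ℤ.- 1ℤ) (+-cancelʳ-≡ (suc k) D (suc (x + y))
            (trans D≡ (trans (cong (_+ 2) (sym x+y+k≡N)) (anti-identity (x + y) k))))))
    }
    where
    D : ℕ
    D = N + 2 ∸ suc k
    D≡ : D + suc k ≡ N + 2
    D≡ = m∸n+n≡m (≤-trans (s≤s (≤-trans k≤H H≤N)) (≤-trans (n≤1+n (suc N)) (≤-reflexive (+-comm 2 N))))
    no-diff : ∀ {x y} → x ∈ J → y ∈ J → x ℤ.- y ≢ + D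
    no-diff x∈ y∈ eq = A≢0 J x∈ y∈ eq (m+n≡0⇒m≡0 _ Fz)
    no-sum : ∀ {x y} → x ∈ J → y ∈ J → x ℤ.+ y ≢ + D ℤ.- 1ℤ
    no-sum x∈ y∈ eq = B≢0 J {d = D} x∈ y∈ eq (m+n≡0⇒n≡0 (A[ D ] J) Fz)
    N-identity : ∀ n → n ≡ n ℤ.+ + 2 ℤ.- 1ℤ ℤ.- 1ℤ
    N-identity = ℤSolver.solve-∀
    k-identity : ∀ D k → D ℤ.+ (1ℤ ℤ.+ k) ℤ.- 1ℤ ℤ.- 1ℤ ≡ D ℤ.+ k ℤ.- 1ℤ
    k-identity = ℤSolver.solve-∀
    N≡ : + N ≡ + D ℤ.+ + k ℤ.- 1ℤ
    N≡ = trans (N-identity (+ N)) (trans (cong (λ t → + t ℤ.- 1ℤ ℤ.- 1ℤ) (sym D≡)) (k-identity (+ D) (+ k)))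
    shift-identity : ∀ x k D → x ℤ.+ (D ℤ.+ k ℤ.- 1ℤ ℤ.- (x ℤ.+ k)) ≡ D ℤ.- 1ℤ
    shift-identity = ℤSolver.solve-∀
    reflect-identity : ∀ x y D → D ℤ.+ (x ℤ.+ (1ℤ ℤ.+ y)) ℤ.- 1ℤ ℤ.- y ℤ.- x ≡ D
    reflect-identity = ℤSolver.solve-∀
    anti-identity : ∀ n k → n + k + 2 ≡ suc n + suc k
    anti-identity = solve-∀
    excluded : ∀ {x} → x ≤ H → ¬ (x ∈ U) → In x ⊎ x ≡ r
    excluded {x} x≤H x∉U with x ≟ r
    ... | yes x≡r = inj₂ x≡r
    ... | no  x≢r with side x≤H x≢r
    ...   | inj₁ p   = inj₁ p
    ...   | inj₂ x∈U = ⊥-elim (x∉U x∈U)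

  Same : ℕ → ℕ → Set
  Same x y = In x × In y ⊎ x ∈ U × y ∈ U

  -- A same-side pair `i`, `i + d` appears in `J` as `(i + d, i)` or as `(N - i, N - (i + d))`. The
  -- two lists read `i` off the second or the first coordinate, so each difference pair leaves two
  -- traces. Subtracting `s` recovers `i` when the pair begins at `i + s`.
  traces : ℕ → ℕ → List ℕ
  traces d s = map (λ (x , y) → ∣ y ∣ ∸ s) (difference-pairs J d)
            ++ map (λ (x , y) → ∣ + N ℤ.- x ∣ ∸ s) (difference-pairs J d)

  length-traces : ∀ d s → length (traces d s) ≡ A[ d ] J + A[ d ] J
  length-traces d s = trans (length-++ (map _ (difference-pairs J d)))
    (cong₂ _+_ (length-map _ (difference-pairs J d)) (length-map _ (difference-pairs J d)))

  ∈-traces : ∀ {i d} s → Same i (i + d) → i ∸ s ∈ᴸ traces d s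
  ∈-traces {i} {d} s (inj₁ (p , q)) = ∈-++⁺ˡ (∈-map⁺ (λ (x , y) → ∣ y ∣ ∸ s)
    (∈-difference-pairs J (lower∈J q) (lower∈J p) (identity (+ i) (+ d))))
    where
    identity : ∀ i d → i ℤ.+ d ℤ.- i ≡ d
    identity = ℤSolver.solve-∀
  ∈-traces {i} {d} s (inj₂ (p , q)) = ∈-++⁺ʳ (map _ (difference-pairs J d))
    (subst (λ t → ∣ t ∣ ∸ s ∈ᴸ _) (involution (+ N) (+ i))
      (∈-map⁺ (λ (x , y) → ∣ + N ℤ.- x ∣ ∸ s)
        (∈-difference-pairs J (upper∈J p) (upper∈J q) (identity (+ N) (+ i) (+ d)))))
    where
    involution : ∀ n i → n ℤ.- (n ℤ.- i) ≡ i
    involution = ℤSolver.solve-∀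
    identity : ∀ n i d → n ℤ.- i ℤ.- (n ℤ.- (i ℤ.+ d)) ≡ d
    identity = ℤSolver.solve-∀

  three-points : ∀ n p q → n + (p + q) ≤ H →
    n ≤ 3 + 2 * (A[ p ] J + A[ q ] J + A[ p + q ] J)
  three-points n p q n+p+q≤H = begin
    n                   ≤⟨ upTo⊆⇒≤-length n ys member ⟩
    length ys           ≡⟨ cong (λ t → 3 + t) lengths ⟩
    3 + (a + a + (b + b + (c + c))) ≡⟨ cong (λ t → 3 + t) (rearrange a b c) ⟩
    3 + 2 * (a + b + c) ∎
    where
    open ≤-Reasoning
    a b c : ℕ
    a = A[ p ] J
    b = A[ q ] J
    c = A[ p + q ] J
    rearrange : ∀ a b c → a + a + (b + b + (c + c)) ≡ 2 * (a + b + c)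
    rearrange = solve-∀
    ys : List ℕ
    -- The first three entries are the `i` for which `i`, `i + p` or `i + (p + q)` is `r`. They
    -- cause the summand 3, and the doubled traces the factor 2.
    ys = r ∷ r ∸ p ∷ r ∸ (p + q) ∷ traces p 0 ++ traces q p ++ traces (p + q) 0
    lengths : length (traces p 0 ++ traces q p ++ traces (p + q) 0) ≡ a + a + (b + b + (c + c))
    lengths = trans (length-++ (traces p 0)) (cong₂ _+_ (length-traces p 0)
      (trans (length-++ (traces q p)) (cong₂ _+_ (length-traces q p) (length-traces (p + q) 0))))
    member : ∀ i → i < n → i ∈ᴸ ys
    member i i<n with i ≟ r | i + p ≟ r | i + (p + q) ≟ r
    ... | yes refl | _ | _ = here refl
    ... | no _ | yes refl | _ = there (here (sym (m+n∸n≡m i p)))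
    ... | no _ | no _ | yes refl = there (there (here (sym (m+n∸n≡m i (p + q)))))
    ... | no i≢r | no i+p≢r | no i+p+q≢r
        with side (≤-trans (m≤m+n i (p + q)) i+p+q≤H) i≢r
           | side (≤-trans (+-monoʳ-≤ i (m≤m+n p q)) i+p+q≤H) i+p≢r
           | side i+p+q≤H i+p+q≢r
      where
      i+p+q≤H : i + (p + q) ≤ H
      i+p+q≤H = ≤-trans (+-monoˡ-≤ (p + q) (≤-trans (n≤1+n i) i<n)) n+p+q≤H
    ...   | inj₁ x | inj₁ y | _      = there (there (there (∈-++⁺ˡ (∈-traces 0 (inj₁ (x , y))))))
    ...   | inj₂ x | inj₂ y | _      = there (there (there (∈-++⁺ˡ (∈-traces 0 (inj₂ (x , y))))))
    ...   | inj₁ x | inj₂ _ | inj₁ z = there (there (there (∈-++⁺ʳ (traces p 0) (∈-++⁺ʳ (traces q p) (∈-traces 0 (inj₁ (x , z)))))))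
    ...   | inj₂ x | inj₁ _ | inj₂ z = there (there (there (∈-++⁺ʳ (traces p 0) (∈-++⁺ʳ (traces q p) (∈-traces 0 (inj₂ (x , z)))))))
    ...   | inj₁ _ | inj₂ y | inj₂ z = there (there (there (∈-++⁺ʳ (traces p 0) (∈-++⁺ˡ (subst (_∈ᴸ traces q p) (m+n∸n≡m i p) (∈-traces p (inj₂ (y , subst (_∈ U) (sym (+-assoc i p q)) z))))))))
    ...   | inj₂ _ | inj₁ y | inj₁ z = there (there (there (∈-++⁺ʳ (traces p 0) (∈-++⁺ˡ (subst (_∈ᴸ traces q p) (m+n∸n≡m i p) (∈-traces p (inj₁ (y , subst In (sym (+-assoc i p q)) z))))))))

  -- The quadratic lower bound.

  module _ {ε : ℕ} (N≡ : N ≡ 2 * H + ε) (ε≤2 : ε ≤ 2) where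

    H≤N : H ≤ N
    H≤N = subst (H ≤_) (sym N≡) (≤-trans (m≤m+n H (H + 0)) (m≤m+n (2 * H) ε))

    Z-sparse : ∀ {lo hi} → 4 ≤ lo → hi ≤ H → hi ≤ r ⊎ r + r + 5 ≤ lo → Sparse Z lo hi
    Z-sparse 4≤lo hi≤H far {zero} lo≤a with () ← ≤-trans 4≤lo lo≤a
    Z-sparse 4≤lo hi≤H far {a@(suc κ)} lo≤a a<b b<c c≤a+4 c<hi za zb zc
      with d′ , refl ← m≤n⇒∃[o]m+o≡n a<b with e′ , refl ← m≤n⇒∃[o]m+o≡n b<c
      = no-three-zeros In r H In0 {κ = κ} {d′} {e′} d′+e′≤2 k₃≤H far′
          (zero-at (≤-trans a≤c c≤H) H≤N za)
          (subst (Zero In r H N) k₂≡ (zero-at (≤-trans (≤-trans (n≤1+n _) b<c) c≤H) H≤N zb))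
          (subst (Zero In r H N) k₃≡ (zero-at c≤H H≤N zc))
          N≡ ε≤2 (≤-trans 4≤lo lo≤a)
      where
      c : ℕ
      c = suc (suc a + d′) + e′
      c≤H : c ≤ H
      c≤H = ≤-trans (<⇒≤ c<hi) hi≤H
      a≤c : a ≤ c
      a≤c = ≤-trans (≤-trans (n≤1+n a) a<b) (≤-trans (n≤1+n _) b<c)
      k₂≡ : suc a + d′ ≡ a + suc d′
      k₂≡ = sym (+-suc a d′)
      k₃≡ : c ≡ a + suc d′ + suc e′
      k₃≡ = trans (cong (λ t → suc t + e′) k₂≡) (sym (+-suc (a + suc d′) e′))
      k₃≤H : a + suc d′ + suc e′ ≤ H
      k₃≤H = subst (_≤ H) k₃≡ c≤H
      rearrange : ∀ a d e → suc (suc a + d) + e ≡ a + (2 + (d + e))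
      rearrange = solve-∀
      d′+e′≤2 : d′ + e′ ≤ 2
      d′+e′≤2 = ≤-pred (≤-pred (+-cancelˡ-≤ a _ _ (subst (_≤ a + 4) (rearrange a d′ e′) c≤a+4)))
      far′ : a + suc d′ + suc e′ < r ⊎ r + r + 5 ≤ a
      far′ = map-⊎ (λ hi≤r → subst (_< r) k₃≡ (<-≤-trans c<hi hi≤r)) (λ le → ≤-trans le lo≤a) far

    P≡prefix : P N J ≡ prefix g (suc N)
    P≡prefix = trans (cong sum (map-applyUpTo suc _ (N + 1))) (cong (prefix g) (+-comm N 1))

    -- Each of `m` windows gains `h`. In `room`, `h + 3` is the number of base points for
    -- `three-points`, the 3 paying for its loss at `r`, and `w + w` bounds the sum of the two
    -- differences. The three prefix sums are each at most `P N J`, giving 6.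
    P-bound : ∀ m lo h → let w = m * 5 + lo in 4 ≤ lo → w + w ≤ r ⊎ r + r + 5 ≤ lo →
              h + 3 + (w + w) ≤ H → m * h ≤ 6 * P N J
    P-bound m lo h 4≤lo far room = begin
      m * h ≤⟨ windows-sum g m window ⟩
      2 * (prefix g w + prefix g w + prefix g (suc (w + w)))
        ≤⟨ *-monoʳ-≤ 2 (+-mono-≤ (+-mono-≤ (prefix-mono g w≤) (prefix-mono g w≤)) (prefix-mono g (s≤s 2w≤N))) ⟩
      2 * (p + p + p) ≡⟨ rearrange p ⟩
      6 * p           ≡⟨ cong (6 *_) P≡prefix ⟨
      6 * P N J       ∎
      where
      open ≤-Reasoning
      w p : ℕ
      w = m * 5 + lo
      p = prefix g (suc N)
      rearrange : ∀ p → 2 * (p + p + p) ≡ 6 * p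
      rearrange = solve-∀
      hi≤H : w + w ≤ H
      hi≤H = ≤-trans (m≤n+m (w + w) (h + 3)) room
      2w≤N : w + w ≤ N
      2w≤N = ≤-trans hi≤H H≤N
      w≤ : w ≤ suc N
      w≤ = ≤-trans (m≤m+n w w) (≤-trans 2w≤N (n≤1+n N))
      window : ∀ t → t < m → let w = t * 5 + lo in
        ∃[ i ] ∃[ j ] i < 5 × j < 5 ×
          h ≤ 2 * (g (w + i) + g (w + j) + g (suc (w + i + (w + j))))
      window t t<m with good-triple {Z} (Z-sparse 4≤lo hi≤H far) (λ k → F (N + 2 ∸ suc k) ≟ 0)
                          (t * 5 + lo) (m≤n+m lo (t * 5)) 2v+10≤hi
        where
        v+5≤w : 5 + (t * 5 + lo) ≤ w
        v+5≤w = +-monoˡ-≤ lo (*-monoˡ-≤ 5 t<m)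
        double : ∀ v → v + v + 10 ≡ 5 + v + (5 + v)
        double = solve-∀
        2v+10≤hi : t * 5 + lo + (t * 5 + lo) + 10 ≤ w + w
        2v+10≤hi = ≤-trans (≤-reflexive (double (t * 5 + lo))) (+-mono-≤ v+5≤w v+5≤w)
      ... | i , j , i<5 , j<5 , ¬zi , ¬zj , ¬zs = i , j , i<5 , j<5 ,
        +-cancelˡ-≤ 3 _ _ (begin
          3 + h ≡⟨ +-comm 3 h ⟩
          h + 3 ≤⟨ three-points (h + 3) (suc (v + i)) (suc (v + j))
                     (≤-trans (+-monoʳ-≤ (h + 3) (+-mono-≤ (v+<w i<5) (v+<w j<5))) room) ⟩
          3 + 2 * (A[ suc (v + i) ] J + A[ suc (v + j) ] J + A[ suc (v + i) + suc (v + j) ] J)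
            ≤⟨ +-monoʳ-≤ 3 (*-monoʳ-≤ 2 (+-mono-≤ (+-mono-≤ (A≤g ¬zi) (A≤g ¬zj))
                 (subst (λ t → A[ t ] J ≤ g s) (cong suc (sym (+-suc (v + i) (v + j)))) (A≤g ¬zs)))) ⟩
          3 + 2 * (g (v + i) + g (v + j) + g s) ∎)
        where
        v s : ℕ
        v = t * 5 + lo
        s = suc (v + i + (v + j))
        v+<w : ∀ {i} → i < 5 → v + i < w
        v+<w {i} i<5 = ≤-trans (≤-trans (+-monoʳ-< v i<5) (≤-reflexive (+-comm v 5)))
                         (+-monoˡ-≤ lo (*-monoˡ-≤ 5 t<m))

    -- The windows must avoid the range from `r` to `2r + 4`. If `r ≥ 10m + 8` they fit below `r`,
    -- starting at 4, the least `k₁` that `no-three-zeros` admits.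
    quadratic : ∀ m → 1 ≤ m → m * 200 ≤ H → m * (100 * m) ≤ 6 * P N J
    quadratic m 1≤m 200m≤H with (m * 5 + 4) + (m * 5 + 4) ≤? r
    ... | yes hi≤r = P-bound m 4 (100 * m) ≤-refl (inj₁ hi≤r) (begin
        100 * m + 3 + (m * 5 + 4 + (m * 5 + 4)) ≡⟨ expand m ⟩
        110 * m + 11 * 1                        ≤⟨ +-monoʳ-≤ (110 * m) (*-mono-≤ (m≤m+n 11 79) 1≤m) ⟩
        110 * m + 90 * m                        ≡⟨ collect m ⟩
        m * 200                                 ≤⟨ 200m≤H ⟩
        H                                       ∎)
      where
      open ≤-Reasoning
      expand : ∀ m → 100 * m + 3 + (m * 5 + 4 + (m * 5 + 4)) ≡ 110 * m + 11
      expand = solve-∀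
      collect : ∀ m → 110 * m + 90 * m ≡ m * 200
      collect = solve-∀
    -- Now `r ≤ 10m + 7`, so `2r + 5 ≤ 20m + 19` and the windows can start at `20m + 20`.
    ... | no hi≰r = P-bound m (20 * m + 20) (100 * m) (≤-trans (m≤m+n 4 16) (m≤n+m 20 (20 * m)))
        (inj₂ (begin
          r + r + 5           ≡⟨ shift r ⟩
          suc r + suc r + 3   ≤⟨ +-monoˡ-≤ 3 (+-mono-≤ r<θ r<θ) ⟩
          θ + θ + 3           ≤⟨ +-monoʳ-≤ (θ + θ) (m≤m+n 3 1) ⟩
          θ + θ + 4           ≡⟨ expand-θ m ⟩
          20 * m + 20         ∎))
        (begin
        100 * m + 3 + (m * 5 + (20 * m + 20) + (m * 5 + (20 * m + 20))) ≡⟨ expand m ⟩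
        150 * m + 43 * 1                        ≤⟨ +-monoʳ-≤ (150 * m) (*-mono-≤ (m≤m+n 43 7) 1≤m) ⟩
        150 * m + 50 * m                        ≡⟨ collect m ⟩
        m * 200                                 ≤⟨ 200m≤H ⟩
        H                                       ∎)
      where
      open ≤-Reasoning
      θ : ℕ
      θ = m * 5 + 4 + (m * 5 + 4)
      r<θ : r < θ
      r<θ = ≰⇒> hi≰r
      shift : ∀ r → r + r + 5 ≡ suc r + suc r + 3
      shift = solve-∀
      expand-θ : ∀ m → m * 5 + 4 + (m * 5 + 4) + (m * 5 + 4 + (m * 5 + 4)) + 4 ≡ 20 * m + 20
      expand-θ = solve-∀
      expand : ∀ m → 100 * m + 3 + (m * 5 + (20 * m + 20) + (m * 5 + (20 * m + 20))) ≡ 150 * m + 43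
      expand = solve-∀
      collect : ∀ m → 150 * m + 50 * m ≡ m * 200
      collect = solve-∀

    H²≤10000P : 200 ≤ H → H ^ 2 ≤ P N J * 10000
    H²≤10000P 200≤H = begin
      -- For `m = H div 200 ≥ 1` one has `H ≤ 400m`, so `H ^ 2` is at most 1600 times `100m²`, hence
      -- at most `9600 * P N J`; 10000 is a round value above this.
      H ^ 2                     ≤⟨ ^-monoˡ-≤ 2 H≤400m ⟩
      (m * 400) ^ 2             ≡⟨ expand m ⟩
      1600 * (m * (100 * m))    ≤⟨ *-monoʳ-≤ 1600 (quadratic m 1≤m (m/n*n≤m H 200)) ⟩
      1600 * (6 * P N J)        ≡⟨ *-assoc 1600 6 (P N J) ⟨
      9600 * P N J              ≤⟨ *-monoˡ-≤ (P N J) (m≤m+n 9600 400) ⟩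
      10000 * P N J             ≡⟨ *-comm 10000 (P N J) ⟩
      P N J * 10000             ∎
      where
      open ≤-Reasoning
      m : ℕ
      m = H div 200
      1≤m : 1 ≤ m
      1≤m = m≥n⇒m/n>0 200≤H
      expand : ∀ m → m * 400 * (m * 400 * 1) ≡ 1600 * (m * (100 * m))
      expand = solve-∀
      H≤400m : H ≤ m * 400
      H≤400m = begin
        H                     ≡⟨ m≡m%n+[m/n]*n H 200 ⟩
        H % 200 + m * 200     ≤⟨ +-monoˡ-≤ (m * 200) (≤-trans (<⇒≤ (m%n<n H 200)) (*-monoˡ-≤ 200 1≤m)) ⟩
        m * 200 + m * 200     ≡⟨ *-distribˡ-+ m 200 200 ⟨
        m * 400               ∎

-- Passage to rationals and conclusion.

integers/1 : ∀ n → ℚ.toℚᵘ (+ n / 1) ℚᵘ.≃ ℚᵘ.mkℚᵘ (+ n) 0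
integers/1 n = ℚₚ.toℚᵘ-fromℚᵘ (ℚᵘ.mkℚᵘ (+ n) 0)

rational-bound : ∀ {a b} → a ≤ b * 10000 → (+ 1 / 10000) ℚ.* (+ a / 1) ℚ.≤ + b / 1
rational-bound {a} {b} a≤ = ℚₚ.toℚᵘ-cancel-≤ (begin
  ℚ.toℚᵘ (c ℚ.* (+ a / 1))           ≃⟨ ℚₚ.toℚᵘ-homo-* c (+ a / 1) ⟩
  ℚ.toℚᵘ c ℚᵘ.* ℚ.toℚᵘ (+ a / 1)     ≃⟨ ℚᵘₚ.*-congˡ {ℚ.toℚᵘ c} (integers/1 a) ⟩
  ℚ.toℚᵘ c ℚᵘ.* ℚᵘ.mkℚᵘ (+ a) 0        ≤⟨ ℚᵘ.*≤* (ℤₚ.≤-trans (ℤₚ.≤-reflexive (numerator (+ a))) (ℤₚ.≤-trans (ℤ.+≤+ a≤) (ℤₚ.≤-reflexive (ℤₚ.pos-* b 10000)))) ⟩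
  ℚᵘ.mkℚᵘ (+ b) 0                      ≃⟨ integers/1 b ⟨
  ℚ.toℚᵘ (+ b / 1)                   ∎)
  where
  open ℚᵘₚ.≤-Reasoning
  c : ℚ
  c = + 1 / 10000
  numerator : ∀ a → 1ℤ ℤ.* a ℤ.* 1ℤ ≡ a
  numerator = ℤSolver.solve-∀

theorem7p9 : Σ[ c ∈ ℚ ] Σ[ H₀ ∈ ℕ ] (0ℚ ℚ.< c) ×
    ((H : ℕ) → H₀ ≤ H →
    (ε : ℕ) → (ε ≡ 1 ⊎ ε ≡ 2) →
    (r : ℕ) → 1 ≤ r → r ≤ H →
    (L U : FinSet ℕ) → IsPartition H r L U →
    let N = 2 * H + ε in
    c ℚ.* (+ (H ^ 2) / 1) ℚ.≤ + P N (J[ N ] L U) / 1)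
theorem7p9 = + 1 / 10000 , 200 , ℚₚ.positive⁻¹ (+ 1 / 10000) ,
  λ H 200≤H ε ε∈ r _ _ L U partition →
    rational-bound {H ^ 2} {P (2 * H + ε) (J[ 2 * H + ε ] L U)}
      (Structure.H²≤10000P L U partition refl (ε≤2 ε∈) 200≤H)
  where
  ε≤2 : ∀ {ε} → ε ≡ 1 ⊎ ε ≡ 2 → ε ≤ 2
  ε≤2 (inj₁ refl) = m≤m+n 1 1
  ε≤2 (inj₂ refl) = ≤-refl
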